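{- For any set $\mathcal{O}$ of upwards closed modalities, the logical preorder $\sqsubseteq_{\mathcal{V}^+}$ (on closed values and on closed computations of each type) is identical to applicative $\mathcal{O}$-similarity.
   Context: Language: types $\tau ::= \mathbf{1} \mid \mathbf{N} \mid \tau \to \tau'$; signature $\Sigma$ of effect operations with arities $\alpha^n\to\alpha$, $\mathbf{N}\times\alpha^n\to\alpha$, $\alpha^{\mathbf{N}}\to\alpha$ or $\mathbf{N}\times\alpha^{\mathbf{N}}\to\alpha$. Values $V ::= * \mid Z \mid S(V) \mid \lambda x{:}\tau.M \mid x$; computations $M ::= VW \mid \mathbf{return}\,V \mid \mathbf{let}\ M\Rightarrow x\ \mathbf{in}\ N \mid \mathbf{fix}(V) \mid \mathbf{case}\ V\ \mathbf{of}\ \{Z\Rightarrow M; S(x)\Rightarrow N\} \mid \sigma(M_0,\dots) \mid \sigma(V;M_0,\dots) \mid \sigma(V)\mid\sigma(V;W)$, simply typed call-by-value. $\mathit{Val}(\tau)$, $\mathit{Com}(\tau)$: closed values/computations; $\overline{n}=S^n(Z)$. Effect trees $TX$: possibly infinite trees with leaves $\bot$ or elements of $X$ and internal nodes labelled by effect operations $\sigma$ (or $\sigma_m$, $m\in\mathbb{N}$, for arities with a $\mathbf{N}$ parameter) with $n$ or $\mathbb{N}$-many children according to the arity; $t\le t'$ iff $t$ results from $t'$ by replacing subtrees with $\bot$. Each $M\in\mathit{Com}(\tau)$ has an operational effect tree $|M|\in T(\mathit{Val}(\tau))$ from call-by-value evaluation (leaves = returned values, nodes = effect operations encountered, $\bot$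 = divergence). Modalities: set $\mathcal{O}$, each $o$ with $[\![o]\!]\subseteq T\mathbf{1}$; for $t\in TX$, $P\subseteq X$, $t[\in P]\in T\mathbf{1}$ replaces leaves in $P$ by $*$ and other $X$-leaves by $\bot$; $o(A)=\{t\mid t[\in A]\in[\![o]\!]\}$. Upwards closed: $[\![o]\!]$ upward closed under $\le$. Logic $\mathcal{V}^+$: value formulas $VF(\tau)$ and computation formulas $CF(\tau)$: $\{n\}\in VF(\mathbf{N})$; $(V\mapsto\Phi)\in VF(\tau\to\tau')$ for $V\in\mathit{Val}(\tau)$, $\Phi\in CF(\tau')$; $o\,\phi\in CF(\tau)$ for $o\in\mathcal{O}$, $\phi\in VF(\tau)$; closed under arbitrary $\bigwedge,\bigvee$ (no negation). Semantics: $W\models\{n\}$ iff $W=\overline{n}$; $W\models(V\mapsto\Phi)$ iff $WV\models\Phi$; $M\models o\phi$ iff $|M|[\in\{V\mid V\models\phi\}]\in[\![o]\!]$. $V\sqsubseteq_{\mathcal{V}^+}W$ iff all formulas satisfied by $V$ are satisfied by $W$ (similarly for computations). Relator: for $R\subseteq X\times Y$ and $A\subseteq X$, $R[A]=\{y\mid\exists x\in A,\ xRy\}$; $t\,\mathcal{O}(R)\,t'$ iff $\forall A\subseteq X\ \forall o\in\mathcal{O}$, $t\in o(A)\Rightarrow t'\in o(R[A])$. An applicative $\mathcal{O}$-simulation is a family $R^v_\tau\subseteq\mathit{Val}(\tau)^2$, $R^c_\tau\subseteq\mathit{Com}(\tau)^2$ with: (1) $V R^v_{\mathbf{N}} W\Rightarrow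 V=W$; (2) $M R^c_\tau N\Rightarrow |M|\,\mathcal{O}(R^v_\tau)\,|N|$; (3) $V R^v_{\tau'\to\tau} W\Rightarrow \forall U\in\mathit{Val}(\tau')$, $VU\,R^c_\tau\,WU$. Applicative $\mathcal{O}$-similarity is the union of all applicative $\mathcal{O}$-simulations. -}

module Defs where

open import Data.Fin.Base using (Fin)
open import Data.List.Base using (List; []; _∷_; _∷ʳ_)
open import Data.List.Membership.Propositional using (_∈_)
open import Data.List.Relation.Unary.Any using (here; there)
open import Data.Nat.Base using (ℕ; zero; suc)
open import Data.Product.Base using (Σ; Σ-syntax; ∃; ∃-syntax; _×_; _,_)
open import Data.Sum.Base using (_⊎_; inj₁; inj₂)
open import Data.Unit.Base using (⊤; tt)
open import Data.Vec.Base using (Vec; []; _∷_; lookup)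
open import Level using (0ℓ)
open import Relation.Binary.Core using (REL; Rel)
open import Relation.Binary.PropositionalEquality using (_≡_; refl; sym; trans)
open import Relation.Unary using (Pred)

infixr 7 _⇒_

data Type : Set where
  𝟏 N : Type
  _⇒_ : Type → Type → Type

Ctx : Set
Ctx = List Type

data Arity : Set where
  αⁿ→α   : ℕ → Arity
  N×αⁿ→α : ℕ → Arity
  αᴺ→α   : Arity
  N×αᴺ→α : Arity

Param : Arity → Set
Param (αⁿ→α _)   = ⊤
Param (N×αⁿ→α _) = ℕ
Param αᴺ→α       = ⊤
Param N×αᴺ→α     = ℕ

Branch : Arity → Set
Branch (αⁿ→α n)   = Fin n
Branch (N×αⁿ→α n) = Fin n
Branch αᴺ→α       = ℕ
Branch N×αᴺ→α     = ℕ

record Signature : Set₁ where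
  field
    Op    : Set
    arity : Op → Arity

module Trees (Sig : Signature) where

  open Signature Sig

  Node : Set
  Node = Σ[ σ ∈ Op ] Param (arity σ)

  Child : Node → Set
  Child (σ , _) = Branch (arity σ)

  -- A position, read from the root downwards: at each node passed, its
  -- label and the child chosen.
  Path : Set
  Path = List (Σ Node Child)

  data Label (X : Set) : Set where
    leaf : X → Label X
    node : Node → Label X

  -- A possibly infinite tree is given by the partial labelling of its
  -- positions: At p a says that the subtree at p has root a.  The root and
  -- the children of a node that carry no label are the leaves ⊥.
  record Tree (X : Set) : Set₁ where
    field
      At         : Path → Label X → Set
      functional : ∀ {p a b} → At p a → At p b → a ≡ b
      parent     : ∀ p {l i a} → At (p ∷ʳ (l , i)) a → At p (node l)

  open Tree public

  -- Replacing subtrees by ⊥ is the same as removing labels.  In particular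
  -- trees with the same labelling are below each other.
  infix 4 _≤_
  _≤_ : ∀ {X} → Tree X → Tree X → Set
  t ≤ t′ = ∀ {p a} → At t p a → At t′ p a

  module _ {X : Set} (t : Tree X) (P : Pred X 0ℓ) where

    data RestrictAt : Path → Label ⊤ → Set where
      leaf : ∀ {p x} → At t p (leaf x) → P x → RestrictAt p (leaf tt)
      node : ∀ {p l} → At t p (node l) → RestrictAt p (node l)

    private
      functional′ : ∀ {p a b} → RestrictAt p a → RestrictAt p b → a ≡ b
      functional′ (leaf _ _) (leaf _ _) = refl
      functional′ (leaf u _) (node v) with () ← functional t u v
      functional′ (node u) (leaf v _) with () ← functional t u v
      functional′ (node u) (node v) with refl ← functional t u v = refl

      parent′ : ∀ p {l i a} → RestrictAt (p ∷ʳ (l , i)) a → RestrictAt p (node l)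
      parent′ p (leaf u _) = node (parent t p u)
      parent′ p (node u)   = node (parent t p u)

    infix 8 _[∈_]
    _[∈_] : Tree ⊤
    _[∈_] = record { At = RestrictAt ; functional = functional′ ; parent = parent′ }

  record Modalities : Set₁ where
    field
      O   : Set
      ⟦_⟧ : O → Pred (Tree ⊤) 0ℓ

  UpwardsClosed : Modalities → Set₁
  UpwardsClosed 𝒪 = ∀ o {t t′} → t ≤ t′ → ⟦ o ⟧ t → ⟦ o ⟧ t′
    where open Modalities 𝒪

module Language (Sig : Signature) where

  open Signature Sig
  open Trees Sig

  infix 9 _·_

  data Value (Γ : Ctx) : Type → Set
  data Comp  (Γ : Ctx) : Type → Set
  data Args  (Γ : Ctx) (τ : Type) : Arity → Set

  data Value Γ where
    var : ∀ {τ} → τ ∈ Γ → Value Γ τ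
    *   : Value Γ 𝟏
    Z   : Value Γ N
    S   : Value Γ N → Value Γ N
    lam : ∀ {ρ τ} → Comp (ρ ∷ Γ) τ → Value Γ (ρ ⇒ τ)

  data Comp Γ where
    _·_    : ∀ {ρ τ} → Value Γ (ρ ⇒ τ) → Value Γ ρ → Comp Γ τ
    return : ∀ {τ} → Value Γ τ → Comp Γ τ
    let′   : ∀ {ρ τ} → Comp Γ ρ → Comp (ρ ∷ Γ) τ → Comp Γ τ
    fix    : ∀ {ρ τ} → Value Γ ((ρ ⇒ τ) ⇒ (ρ ⇒ τ)) → Comp Γ (ρ ⇒ τ)
    case   : ∀ {τ} → Value Γ N → Comp Γ τ → Comp (N ∷ Γ) τ → Comp Γ τ
    op     : ∀ {τ} (σ : Op) → Args Γ τ (arity σ) → Comp Γ τ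

  data Args Γ τ where
    ⟨_⟩   : ∀ {n} → Vec (Comp Γ τ) n → Args Γ τ (αⁿ→α n)
    ⟨_⨾_⟩ : ∀ {n} → Value Γ N → Vec (Comp Γ τ) n → Args Γ τ (N×αⁿ→α n)
    ⟨_⟩ᴺ   : Value Γ (N ⇒ τ) → Args Γ τ αᴺ→α
    ⟨_⨾_⟩ᴺ : Value Γ N → Value Γ (N ⇒ τ) → Args Γ τ N×αᴺ→α

  Val Com : Type → Set
  Val = Value []
  Com = Comp []

  numeral : ℕ → Val N
  numeral zero    = Z
  numeral (suc n) = S (numeral n)

  toℕ : Val N → ℕ
  toℕ Z     = zero
  toℕ (S V) = suc (toℕ V)

  Ren Sub : Ctx → Ctx → Set
  Ren Γ Δ = ∀ {τ} → τ ∈ Γ → τ ∈ Δ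
  Sub Γ Δ = ∀ {τ} → τ ∈ Γ → Value Δ τ

  liftᴿ : ∀ {Γ Δ ρ} → Ren Γ Δ → Ren (ρ ∷ Γ) (ρ ∷ Δ)
  liftᴿ r (here e)  = here e
  liftᴿ r (there x) = there (r x)

  renᵛ : ∀ {Γ Δ τ} → Ren Γ Δ → Value Γ τ → Value Δ τ
  renᶜ : ∀ {Γ Δ τ} → Ren Γ Δ → Comp Γ τ → Comp Δ τ
  renᵃ : ∀ {Γ Δ τ a} → Ren Γ Δ → Args Γ τ a → Args Δ τ a
  ren* : ∀ {Γ Δ τ n} → Ren Γ Δ → Vec (Comp Γ τ) n → Vec (Comp Δ τ) n

  renᵛ r (var x) = var (r x)
  renᵛ r *       = *
  renᵛ r Z       = Z
  renᵛ r (S V)   = S (renᵛ r V)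
  renᵛ r (lam M) = lam (renᶜ (liftᴿ r) M)

  renᶜ r (V · W)      = renᵛ r V · renᵛ r W
  renᶜ r (return V)   = return (renᵛ r V)
  renᶜ r (let′ M M′)  = let′ (renᶜ r M) (renᶜ (liftᴿ r) M′)
  renᶜ r (fix V)      = fix (renᵛ r V)
  renᶜ r (case V M M′) = case (renᵛ r V) (renᶜ r M) (renᶜ (liftᴿ r) M′)
  renᶜ r (op σ A)     = op σ (renᵃ r A)

  renᵃ r ⟨ Ms ⟩      = ⟨ ren* r Ms ⟩
  renᵃ r ⟨ V ⨾ Ms ⟩  = ⟨ renᵛ r V ⨾ ren* r Ms ⟩
  renᵃ r ⟨ V ⟩ᴺ      = ⟨ renᵛ r V ⟩ᴺ
  renᵃ r ⟨ V ⨾ W ⟩ᴺ  = ⟨ renᵛ r V ⨾ renᵛ r W ⟩ᴺ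

  ren* r []       = []
  ren* r (M ∷ Ms) = renᶜ r M ∷ ren* r Ms

  weaken : ∀ {Γ ρ τ} → Value Γ τ → Value (ρ ∷ Γ) τ
  weaken = renᵛ there

  liftˢ : ∀ {Γ Δ ρ} → Sub Γ Δ → Sub (ρ ∷ Γ) (ρ ∷ Δ)
  liftˢ s (here e)  = var (here e)
  liftˢ s (there x) = weaken (s x)

  subᵛ : ∀ {Γ Δ τ} → Sub Γ Δ → Value Γ τ → Value Δ τ
  subᶜ : ∀ {Γ Δ τ} → Sub Γ Δ → Comp Γ τ → Comp Δ τ
  subᵃ : ∀ {Γ Δ τ a} → Sub Γ Δ → Args Γ τ a → Args Δ τ a
  sub* : ∀ {Γ Δ τ n} → Sub Γ Δ → Vec (Comp Γ τ) n → Vec (Comp Δ τ) n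

  subᵛ s (var x) = s x
  subᵛ s *       = *
  subᵛ s Z       = Z
  subᵛ s (S V)   = S (subᵛ s V)
  subᵛ s (lam M) = lam (subᶜ (liftˢ s) M)

  subᶜ s (V · W)      = subᵛ s V · subᵛ s W
  subᶜ s (return V)   = return (subᵛ s V)
  subᶜ s (let′ M M′)  = let′ (subᶜ s M) (subᶜ (liftˢ s) M′)
  subᶜ s (fix V)      = fix (subᵛ s V)
  subᶜ s (case V M M′) = case (subᵛ s V) (subᶜ s M) (subᶜ (liftˢ s) M′)
  subᶜ s (op σ A)     = op σ (subᵃ s A)

  subᵃ s ⟨ Ms ⟩      = ⟨ sub* s Ms ⟩
  subᵃ s ⟨ V ⨾ Ms ⟩  = ⟨ subᵛ s V ⨾ sub* s Ms ⟩
  subᵃ s ⟨ V ⟩ᴺ      = ⟨ subᵛ s V ⟩ᴺ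
  subᵃ s ⟨ V ⨾ W ⟩ᴺ  = ⟨ subᵛ s V ⨾ subᵛ s W ⟩ᴺ

  sub* s []       = []
  sub* s (M ∷ Ms) = subᶜ s M ∷ sub* s Ms

  -- M[V/x], for M with a single free variable x
  infix 8 _[_]
  _[_] : ∀ {ρ τ} → Comp (ρ ∷ []) τ → Val ρ → Com τ
  M [ V ] = subᶜ (λ { (here refl) → V }) M

  infixl 5 _∘let_

  -- Pending let-frames between a computation of the index type and the
  -- final result of type τ
  data Stack (τ : Type) : Type → Set where
    id     : Stack τ τ
    _∘let_ : ∀ {ρ ρ′} → Stack τ ρ′ → Comp (ρ ∷ []) ρ′ → Stack τ ρ

  Config : Type → Set
  Config τ = ∃[ ρ ] Stack τ ρ × Com ρ

  data Outcome (τ : Type) : Set where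
    returns  : Val τ → Outcome τ
    performs : (l : Node) → (Child l → Config τ) → Outcome τ

  unpack : ∀ {τ a} → Args [] τ a → Param a × (Branch a → Com τ)
  unpack ⟨ Ms ⟩      = tt    , lookup Ms
  unpack ⟨ V ⨾ Ms ⟩  = toℕ V , lookup Ms
  unpack ⟨ V ⟩ᴺ      = tt    , λ n → V · numeral n
  unpack ⟨ V ⨾ W ⟩ᴺ  = toℕ V , λ n → W · numeral n

  -- λ x. let fix(V) ⇒ y in y x, so that fix(V) steps to V (λ x. …)
  unfold : ∀ {ρ τ} → Val ((ρ ⇒ τ) ⇒ (ρ ⇒ τ)) → Val (ρ ⇒ τ)
  unfold V = lam (let′ (fix (weaken V))
                       (var (here refl) · var (there (here refl))))

  step : ∀ {τ} → Config τ → Config τ ⊎ Outcome τ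
  step (_ , K , lam M · V)          = inj₁ (_ , K , M [ V ])
  step (_ , id , return V)          = inj₂ (returns V)
  step (_ , K ∘let M , return V)    = inj₁ (_ , K , M [ V ])
  step (_ , K , let′ M M′)          = inj₁ (_ , K ∘let M′ , M)
  step (_ , K , fix V)              = inj₁ (_ , K , V · unfold V)
  step (_ , K , case Z M M′)        = inj₁ (_ , K , M)
  step (_ , K , case (S V) M M′)    = inj₁ (_ , K , M′ [ V ])
  step (_ , K , op σ A) with m , Ms ← unpack A
    = inj₂ (performs (σ , m) λ i → _ , K , Ms i)

  infix 4 _⇓_
  data _⇓_ {τ} (c : Config τ) (r : Outcome τ) : Set where
    now   : step c ≡ inj₂ r → c ⇓ r
    later : ∀ {c′} → step c ≡ inj₁ c′ → c′ ⇓ r → c ⇓ r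

  data EvalAt {τ} (c : Config τ) : Path → Label (Val τ) → Set where
    leaf  : ∀ {V} → c ⇓ returns V → EvalAt c [] (leaf V)
    node  : ∀ {l k} → c ⇓ performs l k → EvalAt c [] (node l)
    child : ∀ {l k i p a} → c ⇓ performs l k → EvalAt (k i) p a → EvalAt c ((l , i) ∷ p) a

  private
    deterministic : ∀ {τ} {c : Config τ} {r r′} → c ⇓ r → c ⇓ r′ → r ≡ r′
    deterministic (now e) (now e′) with refl ← trans (sym e) e′ = refl
    deterministic (now e) (later e′ _) with () ← trans (sym e) e′
    deterministic (later e _) (now e′) with () ← trans (sym e) e′
    deterministic (later e d) (later e′ d′) with refl ← trans (sym e) e′ = deterministic d d′

    functional′ : ∀ {τ} {c : Config τ} {p a b} → EvalAt c p a → EvalAt c p b → a ≡ b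
    functional′ (leaf d) (leaf d′) with refl ← deterministic d d′ = refl
    functional′ (leaf d) (node d′) with () ← deterministic d d′
    functional′ (node d) (leaf d′) with () ← deterministic d d′
    functional′ (node d) (node d′) with refl ← deterministic d d′ = refl
    functional′ (child d u) (child d′ u′) with refl ← deterministic d d′ = functional′ u u′

    parent′ : ∀ {τ} {c : Config τ} p {l i a} → EvalAt c (p ∷ʳ (l , i)) a → EvalAt c p (node l)
    parent′ []      (child d _) = node d
    parent′ (_ ∷ p) (child d u) = child d (parent′ p u)

  ∣_∣ : ∀ {τ} → Com τ → Tree (Val τ)
  ∣ M ∣ = record { At = EvalAt (_ , id , M) ; functional = functional′ ; parent = parent′ }

module Behaviour (Sig : Signature) (𝒪 : Trees.Modalities Sig) where

  open Trees Sig
  open Modalities 𝒪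
  open Language Sig

  infixr 6 _↦_
  infixr 7 _◂_

  data VF : Type → Set₁
  data CF : Type → Set₁

  data VF where
    ｛_｝ : ℕ → VF N
    _↦_  : ∀ {ρ τ} → Val ρ → CF τ → VF (ρ ⇒ τ)
    ⋀ ⋁  : ∀ {τ} {I : Set} → (I → VF τ) → VF τ

  data CF where
    _◂_  : ∀ {τ} → O → VF τ → CF τ
    ⋀ ⋁  : ∀ {τ} {I : Set} → (I → CF τ) → CF τ

  infix 4 _⊨ᵛ_ _⊨ᶜ_

  _⊨ᵛ_ : ∀ {τ} → Val τ → VF τ → Set
  _⊨ᶜ_ : ∀ {τ} → Com τ → CF τ → Set

  W ⊨ᵛ ｛ n ｝  = W ≡ numeral n
  W ⊨ᵛ (V ↦ Φ) = W · V ⊨ᶜ Φ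
  W ⊨ᵛ ⋀ φ     = ∀ i → W ⊨ᵛ φ i
  W ⊨ᵛ ⋁ φ     = ∃ λ i → W ⊨ᵛ φ i

  M ⊨ᶜ (o ◂ φ) = ⟦ o ⟧ (∣ M ∣ [∈ (λ V → V ⊨ᵛ φ) ])
  M ⊨ᶜ ⋀ Φ     = ∀ i → M ⊨ᶜ Φ i
  M ⊨ᶜ ⋁ Φ     = ∃ λ i → M ⊨ᶜ Φ i

  infix 4 _⊑ᵛ_ _⊑ᶜ_ _≲ᵛ_ _≲ᶜ_

  _⊑ᵛ_ : ∀ {τ} → Val τ → Val τ → Set₁
  V ⊑ᵛ W = ∀ φ → V ⊨ᵛ φ → W ⊨ᵛ φ

  _⊑ᶜ_ : ∀ {τ} → Com τ → Com τ → Set₁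
  M ⊑ᶜ M′ = ∀ Φ → M ⊨ᶜ Φ → M′ ⊨ᶜ Φ

  -- t ∈ o(A)
  infix 4 _∈⟨_⟩_
  _∈⟨_⟩_ : ∀ {X} → Tree X → O → Pred X 0ℓ → Set
  t ∈⟨ o ⟩ A = ⟦ o ⟧ (t [∈ A ])

  -- R[A]
  image : ∀ {X Y : Set} → REL X Y 0ℓ → Pred X 0ℓ → Pred Y 0ℓ
  image R A y = ∃[ x ] A x × R x y

  -- 𝒪(R)
  Relator : ∀ {X Y : Set} → REL X Y 0ℓ → Tree X → Tree Y → Set₁
  Relator {X} R t t′ = ∀ (A : Pred X 0ℓ) o → t ∈⟨ o ⟩ A → t′ ∈⟨ o ⟩ image R A

  record IsSimulation (Rᵛ : ∀ τ → Rel (Val τ) 0ℓ) (Rᶜ : ∀ τ → Rel (Com τ) 0ℓ) : Set₁ where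
    field
      nat  : ∀ {V W} → Rᵛ N V W → V ≡ W
      comp : ∀ {τ M M′} → Rᶜ τ M M′ → Relator (Rᵛ τ) ∣ M ∣ ∣ M′ ∣
      app  : ∀ {ρ τ V W} → Rᵛ (ρ ⇒ τ) V W → ∀ U → Rᶜ τ (V · U) (W · U)

  _≲ᵛ_ : ∀ {τ} → Val τ → Val τ → Set₁
  V ≲ᵛ W = ∃[ Rᵛ ] ∃[ Rᶜ ] IsSimulation Rᵛ Rᶜ × Rᵛ _ V W

  _≲ᶜ_ : ∀ {τ} → Com τ → Com τ → Set₁
  M ≲ᶜ M′ = ∃[ Rᵛ ] ∃[ Rᶜ ] IsSimulation Rᵛ Rᶜ × Rᶜ _ M M′

{-# OPTIONS --safe #-}
-- Satisfaction of a formula is preserved along every simulation, by induction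
-- on the formula.  Conversely ⊑ is itself a simulation: each set A of values
-- has a formula whose models are exactly the values above some element of A,
-- namely a disjunction over V ∈ A of conjunctions of formulas separating V
-- from the values not above it.
module Submission where

open import Axiom.ExcludedMiddle using (ExcludedMiddle)
open import Data.Empty using (⊥)
open import Data.Product.Base using (Σ; ∃; _×_; _,_)
open import Function.Bundles using (_⇔_; mk⇔)
open import Level using (0ℓ; suc; lift; lower)
open import Relation.Binary.Core using (Rel)
open import Relation.Binary.PropositionalEquality using (_≡_; refl; sym; trans; cong)
open import Relation.Nullary using (¬_; Dec; yes; no; contradiction)
open import Relation.Nullary.Decidable using (True; toWitness; fromWitness; map′; decidable-stable)
open import Relation.Unary using (Pred; _⊆_)
open import Defs

module _ (Sig : Signature) where

  open Trees Sig

  []-mono : ∀ {X} (t : Tree X) {A B : Pred X 0ℓ} → A ⊆ B → t [∈ A ] ≤ t [∈ B ]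
  []-mono t A⊆B (leaf u a) = leaf u (A⊆B a)
  []-mono t A⊆B (node u)   = node u

  open Language Sig

  numeral-toℕ : (V : Val N) → V ≡ numeral (toℕ V)
  numeral-toℕ Z     = refl
  numeral-toℕ (S V) = cong S (numeral-toℕ V)

  module _ (𝒪 : Modalities) (up : UpwardsClosed 𝒪) where

    open Behaviour Sig 𝒪

    -- Enlarging the set only turns `⊥` leaves into `tt`, so the tree grows. All uses of upwards
    -- closure pass through here.
    ∈⟨⟩-mono : ∀ {X} (t : Tree X) o {A B : Pred X 0ℓ} → A ⊆ B → t ∈⟨ o ⟩ A → t ∈⟨ o ⟩ B
    ∈⟨⟩-mono t o A⊆B = up o ([]-mono t A⊆B)

    module _ {Rᵛ : ∀ τ → Rel (Val τ) 0ℓ} {Rᶜ : ∀ τ → Rel (Com τ) 0ℓ}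
             (sim : IsSimulation Rᵛ Rᶜ) where

      open IsSimulation sim

      simulation⇒⊑ᵛ : ∀ {τ V W} → Rᵛ τ V W → V ⊑ᵛ W
      simulation⇒⊑ᶜ : ∀ {τ M M′} → Rᶜ τ M M′ → M ⊑ᶜ M′

      simulation⇒⊑ᵛ r ｛ n ｝  V≡n     = trans (sym (nat r)) V≡n
      simulation⇒⊑ᵛ r (U ↦ Φ) s       = simulation⇒⊑ᶜ (app r U) Φ s
      simulation⇒⊑ᵛ r (⋀ φ)   s i     = simulation⇒⊑ᵛ r (φ i) (s i)
      simulation⇒⊑ᵛ r (⋁ φ)   (i , s) = i , simulation⇒⊑ᵛ r (φ i) s

      -- The relator is applied to the set of models of `φ`, whose image under `Rᵛ` again consists
      -- of models of `φ` by induction.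
      simulation⇒⊑ᶜ {M′ = M′} r (o ◂ φ) s =
        ∈⟨⟩-mono ∣ M′ ∣ o (λ (V , V⊨φ , rVW) → simulation⇒⊑ᵛ rVW φ V⊨φ)
          (comp r (_⊨ᵛ φ) o s)
      simulation⇒⊑ᶜ r (⋀ Φ) s i       = simulation⇒⊑ᶜ r (Φ i) (s i)
      simulation⇒⊑ᶜ r (⋁ Φ) (i , s)   = i , simulation⇒⊑ᶜ r (Φ i) s

    module _ (em : ExcludedMiddle (suc 0ℓ)) where

      em₀ : ExcludedMiddle 0ℓ
      em₀ = map′ lower lift em

      Separable : ∀ {τ} → Val τ → Val τ → Set₁
      Separable V W = ∃ λ φ → V ⊨ᵛ φ × ¬ W ⊨ᵛ φ

      inseparable⇒⊑ᵛ : ∀ {τ} {V W : Val τ} → ¬ Separable V W → V ⊑ᵛ W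
      inseparable⇒⊑ᵛ ¬sep φ V⊨φ =
        decidable-stable em₀ λ ¬W⊨φ → ¬sep (φ , V⊨φ , ¬W⊨φ)

      -- Conjunctions are indexed by small sets, so χ cannot range over all
      -- formulas satisfied by V; one separating formula per value suffices.
      separator : ∀ {τ} {V W : Val τ} → Dec (Separable V W) → VF τ
      separator (yes (φ , _)) = φ
      -- The empty conjunction is true everywhere: a `W` above `V` is not constrained.
      separator (no _)        = ⋀ {I = ⊥} λ ()

      χ : ∀ {τ} → Val τ → VF τ
      χ {τ} V = ⋀ {I = Val τ} λ W → separator (em {Separable V W})

      -- Generalised to any decision `d`, so that the proof can split on it where `em` would be
      -- stuck.
      ⊨ᵛ-separator : ∀ {τ} {V W : Val τ} (d : Dec (Separable V W)) → V ⊨ᵛ separator d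
      ⊨ᵛ-separator (yes (_ , V⊨φ , _)) = V⊨φ
      ⊨ᵛ-separator (no _)              = λ ()

      separator⇒⊑ᵛ : ∀ {τ} {V W : Val τ} (d : Dec (Separable V W)) → W ⊨ᵛ separator d → V ⊑ᵛ W
      separator⇒⊑ᵛ (yes (_ , _ , ¬W⊨φ)) W⊨φ = contradiction W⊨φ ¬W⊨φ
      separator⇒⊑ᵛ (no ¬sep)            _   = inseparable⇒⊑ᵛ ¬sep

      ⊨ᵛχ : ∀ {τ} (V : Val τ) → V ⊨ᵛ χ V
      ⊨ᵛχ V W = ⊨ᵛ-separator (em {Separable V W})

      χ⇒⊑ᵛ : ∀ {τ} {V W : Val τ} → W ⊨ᵛ χ V → V ⊑ᵛ W
      -- The conjunct at index `W` itself would fail at `W` if anything separated `V` from `W`.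
      χ⇒⊑ᵛ {V = V} {W} W⊨χ = separator⇒⊑ᵛ (em {Separable V W}) (W⊨χ W)

      -- ⊑ lives in Set₁, whereas simulations are Set-valued; excluded middle
      -- resizes it.
      ⊑ᵛ₀ : ∀ τ → Rel (Val τ) 0ℓ
      ⊑ᵛ₀ τ V W = True (em {V ⊑ᵛ W})

      ⊑ᶜ₀ : ∀ τ → Rel (Com τ) 0ℓ
      ⊑ᶜ₀ τ M M′ = True (em {M ⊑ᶜ M′})

      ⊑-isSimulation : IsSimulation ⊑ᵛ₀ ⊑ᶜ₀
      ⊑-isSimulation = record
        { nat  = λ {V} V⊑W → trans (numeral-toℕ V)
                   (sym (toWitness V⊑W ｛ toℕ V ｝ (numeral-toℕ V)))
        ; comp = λ {_} {M} {M′} M⊑M′ A o M∈oA →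
                   let χA = ⋁ {I = Σ _ A} λ (V , _) → χ V in
                   -- The models of `χA` contain `A` (the inner use of monotonicity) and lie in its
                   -- image under `⊑ᵛ₀` (the outer one).
                   ∈⟨⟩-mono ∣ M′ ∣ o (λ ((V , a) , W⊨χ) → V , a , fromWitness (χ⇒⊑ᵛ W⊨χ))
                     (toWitness M⊑M′ (o ◂ χA)
                       (∈⟨⟩-mono ∣ M ∣ o (λ {V} a → (V , a) , ⊨ᵛχ V) M∈oA))
        ; app  = λ V⊑W U → fromWitness λ Φ → toWitness V⊑W (U ↦ Φ)
        }

theorem2 : ExcludedMiddle (suc 0ℓ) →
    (Sig : Signature) (𝒪 : Trees.Modalities Sig) → Trees.UpwardsClosed Sig 𝒪 →
    let open Language Sig
        open Behaviour Sig 𝒪 in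
    ∀ (τ : Type) →
    (∀ (V W : Val τ) → V ⊑ᵛ W ⇔ V ≲ᵛ W) ×
    (∀ (M M′ : Com τ) → M ⊑ᶜ M′ ⇔ M ≲ᶜ M′)
theorem2 em Sig 𝒪 up τ =
  (λ V W → mk⇔
    (λ V⊑W → _ , _ , ⊑-isSimulation Sig 𝒪 up em , fromWitness V⊑W)
    (λ (_ , _ , sim , r) → simulation⇒⊑ᵛ Sig 𝒪 up sim r)) ,
  (λ M M′ → mk⇔
    (λ M⊑M′ → _ , _ , ⊑-isSimulation Sig 𝒪 up em , fromWitness M⊑M′)
    (λ (_ , _ , sim , r) → simulation⇒⊑ᶜ Sig 𝒪 up sim r))
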